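{- For every integer $k\ge 0$ there is a finite set $\mathcal F_k$ of bipartite graphs such that for every graph $G$, $\overline{\mu_\alpha}(G)\le k$ if and only if $G$ is $\mathcal F_k$-free.
   Context: All graphs are finite, simple and undirected. For a graph $G$, $\alpha(G)$ is the maximum size of an independent set and $i(G)$ is the minimum size of a maximal (with respect to inclusion) independent set; the independence gap is $\mu_\alpha(G)=\alpha(G)-i(G)$. The hereditary independence gap is $\overline{\mu_\alpha}(G)=\max\{\mu_\alpha(H): H \text{ an induced subgraph of } G\}$. For a set $\mathcal F$ of graphs, $G$ is $\mathcal F$-free if no induced subgraph of $G$ is isomorphic to a member of $\mathcal F$. -}

module Defs where

open import Data.Bool.Base using (Bool)
open import Data.Fin.Base using (Fin; zero; suc)
open import Data.Fin.Properties using (all?)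
open import Data.Fin.Subset using (Subset; inside; outside; _∈_; _⊂_; ∣_∣)
open import Data.Fin.Subset.Properties using (_∈?_; _⊂?_; anySubset?)
open import Data.List.Base using (List; []; _∷_; [_]; _++_; map; filter)
open import Data.List.Extrema.Nat using (max; min)
open import Data.List.Relation.Unary.Any using (Any)
open import Data.Nat.Base using (ℕ; zero; suc; _∸_)
open import Data.Product.Base using (_×_; ∃-syntax)
open import Data.Vec.Base using ([]; _∷_)
open import Function.Bundles using (_⇔_; _↔_; Inverse)
open import Level using (0ℓ)
open import Relation.Binary.Core using (Rel)
open import Relation.Binary.Definitions using (Decidable; Symmetric; Irreflexive)
open import Relation.Binary.PropositionalEquality using (_≡_; _≢_; refl)
open import Relation.Nullary using (¬_; Dec)
open import Relation.Nullary.Decidable using (_×-dec_; _→-dec_; ¬?)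

-- Finite simple graphs; up to isomorphism the vertex set is Fin order.
record Graph : Set₁ where
  field
    order  : ℕ
    _~_    : Rel (Fin order) 0ℓ
    _~?_   : Decidable _~_
    ~-sym  : Symmetric _~_
    ~-irr  : Irreflexive _≡_ _~_

  Vertex : Set
  Vertex = Fin order

open Graph using (order; Vertex)

subsets : ∀ n → List (Subset n)
subsets zero    = [ [] ]
subsets (suc n) = map (inside ∷_) (subsets n) ++ map (outside ∷_) (subsets n)

module _ (G : Graph) where
  open Graph G using (_~_; _~?_)

  Independent : Subset (order G) → Set
  Independent S = ∀ u v → u ∈ S → v ∈ S → ¬ (u ~ v)

  MaximalIndependent : Subset (order G) → Set
  MaximalIndependent S =
    Independent S × ¬ (∃[ T ] (S ⊂ T × Independent T))

  independent? : ∀ S → Dec (Independent S)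
  independent? S = all? λ u → all? λ v →
    (u ∈? S) →-dec ((v ∈? S) →-dec ¬? (u ~? v))

  maximalIndependent? : ∀ S → Dec (MaximalIndependent S)
  maximalIndependent? S =
    independent? S ×-dec ¬? (anySubset? λ T → (S ⊂? T) ×-dec independent? T)

  α : ℕ
  α = max 0 (map ∣_∣ (filter independent? (subsets (order G))))

  -- The default value order G never matters: a maximal independent set exists
  -- and no vertex subset has more than order G elements.
  i : ℕ
  i = min (order G) (map ∣_∣ (filter maximalIndependent? (subsets (order G))))

  -- Since i ≤ α, the subtraction does not truncate.
  gap : ℕ
  gap = α ∸ i

-- The increasing enumeration of the elements of S.
element : ∀ {n} (S : Subset n) → Fin ∣ S ∣ → Fin n
element (outside ∷ S) k       = suc (element S k)
element (inside  ∷ S) zero    = zero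
element (inside  ∷ S) (suc k) = suc (element S k)

_⟨_⟩ : (G : Graph) → Subset (order G) → Graph
G ⟨ S ⟩ = record
  { order = ∣ S ∣
  ; _~_   = λ u v → element S u ~ element S v
  ; _~?_  = λ u v → element S u ~? element S v
  ; ~-sym = ~-sym
  ; ~-irr = λ { refl → ~-irr refl }
  }
  where open Graph G

hereditaryGap : Graph → ℕ
hereditaryGap G = max 0 (map (λ S → gap (G ⟨ S ⟩)) (subsets (order G)))

infix 4 _≅_

record _≅_ (G H : Graph) : Set where
  open Graph G using () renaming (_~_ to _~ᴳ_)
  open Graph H using () renaming (_~_ to _~ᴴ_)
  field
    bijection : Vertex G ↔ Vertex H
  open Inverse bijection using (to)
  field
    adjacency : ∀ u v → (u ~ᴳ v) ⇔ (to u ~ᴴ to v)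

_-Free_ : List Graph → Graph → Set₁
𝓕 -Free G = ¬ (∃[ S ] Any (λ F → G ⟨ S ⟩ ≅ F) 𝓕)

Bipartite : Graph → Set
Bipartite G = ∃[ c ] IsColouring c
  where
  open Graph G using (_~_)

  IsColouring : (Vertex G → Bool) → Set
  IsColouring c = ∀ u v → u ~ v → c u ≢ c v

{-# OPTIONS --safe #-}
module Submission where

-- An independent set A lying in the closed neighbourhood of an independent set
-- B with |B| + m ≤ |A| makes B a maximal independent set of the bipartite graph
-- G[A ∪ B], whose gap is then at least m; conversely, a maximum independent set
-- and a smallest maximal one form such a pair.  So the hereditary gap exceeds k
-- iff such a pair exists with m = k + 1.  Scan B, keeping only vertices that
-- dominate at least two new elements of A, until the surplus |A| - |B| of the kept
-- part reaches m: each kept vertex contributes at least one to it, so at most m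
-- vertices of B are kept, together with at most 2m elements of A.  Hence the bipartite graphs on at most 3(k + 1)
-- vertices with hereditary gap exceeding k are the only obstructions.

open import Defs
open import Data.Nat.Base using (ℕ; _≤_)
open import Data.List.Base using (List)
open import Data.List.Relation.Unary.All using (All)
open import Data.Product.Base using (Σ-syntax; _×_)
open import Function.Bundles using (_⇔_)

open import Data.Bool.Base using (true; false)
open import Data.Bool.Properties using () renaming (_≟_ to _≟ᵇ_)
open import Data.Fin.Base using (Fin; zero; suc; combine; remQuot)
open import Data.Fin.Properties using (remQuot-combine)
  renaming (_≟_ to _≟ᶠ_; suc-injective to suc-injectiveᶠ)
open import Data.Fin.Subset as Subset
  using (Subset; inside; outside; _∪_; ⁅_⁆; ⋃; ∣_∣) renaming (_∈_ to _∈ˢ_)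
open import Data.Fin.Subset.Properties as Subset
  using (x∈⁅x⁆; x∈⁅y⁆⇒x≡y; x∈p∪q⁻; ∣⁅x⁆∣≡1; p⊆p∪q; q⊆p∪q; p⊂q⇒∣p∣<∣q∣; ∣p∣≤n; ∣⊥∣≡0; ∉⊥)
open import Data.List.Base
  using ([]; _∷_; [_]; _++_; map; filter; take; length; upTo; concatMap; cartesianProductWith; tabulate; allFin)
open import Data.List.Extrema.Nat using (v≤max⁺; min≤v⁺; argmax-sel; argmin-sel; max≤v⁺)
open import Data.List.Membership.Propositional using (_∈_; find; lose)
open import Data.List.Membership.Propositional.Properties
  using ( ∈-map⁺; ∈-map⁻; ∈-++⁺ˡ; ∈-++⁺ʳ; ∈-++⁻; ∈-filter⁺; ∈-filter⁻; ∈-map∘filter⁻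
        ; ∈-concatMap⁺; ∈-concatMap⁻; ∈-cartesianProductWith⁺; ∈-cartesianProductWith⁻
        ; ∈-upTo⁺; ∈-allFin; ∈-tabulate⁺; ∈-tabulate⁻)
open import Data.List.Properties using (length-map; length-++; length-take; length-tabulate)
open import Data.List.Relation.Binary.Subset.Propositional using (_⊆_)
open import Data.List.Relation.Unary.All as All using ([]; _∷_)
import Data.List.Relation.Unary.All.Properties as All
open import Data.List.Relation.Unary.AllPairs.Core using ([]; _∷_)
open import Data.List.Relation.Unary.Any as Any using (Any; here; there; any?)
import Data.List.Relation.Unary.Any.Properties as Any
open import Data.List.Relation.Unary.Unique.Propositional using (Unique)
open import Data.List.Relation.Unary.Unique.Propositional.Properties as Unique using (Unique[x∷xs]⇒x∉xs)
open import Data.Nat.Base using (zero; suc; _+_; _*_; _∸_; _<_; z≤n; s≤s; s≤s⁻¹)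
open import Data.Nat.Properties
open import Data.Nat.Tactic.RingSolver using (solve-∀)
open import Data.Product.Base using (∃₂; ∃-syntax; _,_; proj₁; proj₂; uncurry)
open import Data.Sum.Base as Sum using (_⊎_; inj₁; inj₂; [_,_]′)
open import Data.Vec.Base as Vec using ([]; _∷_)
open import Data.Vec.Properties using (lookup∘tabulate)
open import Function.Base using (_∘_; id)
open import Function.Bundles using (mk⇔; Equivalence; Injection; Inverse)
open import Function.Construct.Identity using (↔-id; ⇔-id)
open import Function.Definitions using (Injective)
open import Function.Properties.Inverse using (↔-sym; ↔⇒↣)
open import Level using (Level)
open import Relation.Binary.Core using (REL)
open import Relation.Binary.Definitions using (Decidable)
open import Relation.Binary.PropositionalEquality using (_≡_; _≢_; refl; sym; trans; cong; cong₂; subst; subst₂)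
open import Relation.Nullary using (¬_; Dec; yes; no; does; contradiction)
open import Relation.Nullary.Decidable using (_×-dec_; _⊎-dec_; ¬?)
import Relation.Unary as Unary
open import Relation.Unary.Properties using (∁?)

open Graph using (order; Vertex)
open Equivalence using (to; from)

private variable
  a b r : Level
  n m : ℕ
  G H : Graph

-- Finite sets as subsets and as lists

subsets-complete : (S : Subset n) → S ∈ subsets n
subsets-complete []            = here refl
subsets-complete (inside  ∷ S) = ∈-++⁺ˡ (∈-map⁺ _ (subsets-complete S))
subsets-complete (outside ∷ S) = ∈-++⁺ʳ _ (∈-map⁺ _ (subsets-complete S))

element-∈ : (S : Subset n) (x : Fin ∣ S ∣) → element S x ∈ˢ S
element-∈ (outside ∷ S) x       = Vec.there (element-∈ S x)
element-∈ (inside  ∷ S) zero    = Vec.here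
element-∈ (inside  ∷ S) (suc x) = Vec.there (element-∈ S x)

element-injective : (S : Subset n) → Injective _≡_ _≡_ (element S)
element-injective (outside ∷ S)                 eq = element-injective S (suc-injectiveᶠ eq)
element-injective (inside  ∷ S) {zero}  {zero}  eq = refl
element-injective (inside  ∷ S) {suc x} {suc y} eq =
  cong suc (element-injective S (suc-injectiveᶠ eq))

element-surjective : (S : Subset n) {v : Fin n} → v ∈ˢ S → ∃[ x ] element S x ≡ v
element-surjective (inside  ∷ S) Vec.here      = zero , refl
element-surjective (inside  ∷ S) (Vec.there p) with x , refl ← element-surjective S p = suc x , refl
element-surjective (outside ∷ S) (Vec.there p) with x , refl ← element-surjective S p = x , refl

elements : Subset n → List (Fin n)
elements S = tabulate (element S)

∈-elements⁻ : (S : Subset n) {v : Fin n} → v ∈ elements S → v ∈ˢ S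
∈-elements⁻ S v∈ with x , refl ← ∈-tabulate⁻ v∈ = element-∈ S x

∈-elements⁺ : (S : Subset n) {v : Fin n} → v ∈ˢ S → v ∈ elements S
∈-elements⁺ S v∈ with x , refl ← element-surjective S v∈ = ∈-tabulate⁺ x

fromList : List (Fin n) → Subset n
fromList = ⋃ ∘ map ⁅_⁆

∈-fromList⁺ : {xs : List (Fin n)} {v : Fin n} → v ∈ xs → v ∈ˢ fromList xs
∈-fromList⁺ (here refl) = p⊆p∪q _ (x∈⁅x⁆ _)
∈-fromList⁺ (there v∈)  = q⊆p∪q _ _ (∈-fromList⁺ v∈)

∈-fromList⁻ : (xs : List (Fin n)) {v : Fin n} → v ∈ˢ fromList xs → v ∈ xs
∈-fromList⁻ []       v∈ = contradiction v∈ ∉⊥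
∈-fromList⁻ (x ∷ xs) v∈ =
  [ here ∘ x∈⁅y⁆⇒x≡y x , there ∘ ∈-fromList⁻ xs ]′ (x∈p∪q⁻ ⁅ x ⁆ (fromList xs) v∈)

∣p∪q∣≤∣p∣+∣q∣ : (p q : Subset n) → ∣ p ∪ q ∣ ≤ ∣ p ∣ + ∣ q ∣
∣p∪q∣≤∣p∣+∣q∣ []            []            = z≤n
∣p∪q∣≤∣p∣+∣q∣ (inside  ∷ p) (inside  ∷ q) =
  s≤s (≤-trans (∣p∪q∣≤∣p∣+∣q∣ p q) (+-monoʳ-≤ ∣ p ∣ (n≤1+n _)))
∣p∪q∣≤∣p∣+∣q∣ (inside  ∷ p) (outside ∷ q) = s≤s (∣p∪q∣≤∣p∣+∣q∣ p q)
∣p∪q∣≤∣p∣+∣q∣ (outside ∷ p) (inside  ∷ q)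
  rewrite +-suc ∣ p ∣ ∣ q ∣ = s≤s (∣p∪q∣≤∣p∣+∣q∣ p q)
∣p∪q∣≤∣p∣+∣q∣ (outside ∷ p) (outside ∷ q) = ∣p∪q∣≤∣p∣+∣q∣ p q

∣fromList∣≤length : (xs : List (Fin n)) → ∣ fromList xs ∣ ≤ length xs
∣fromList∣≤length {n} []       = ≤-reflexive (∣⊥∣≡0 n)
∣fromList∣≤length     (x ∷ xs) = ≤-trans (∣p∪q∣≤∣p∣+∣q∣ ⁅ x ⁆ (fromList xs))
  (+-mono-≤ (≤-reflexive (∣⁅x⁆∣≡1 x)) (∣fromList∣≤length xs))

-- A head missing from the tail makes the inclusion of sets strict, so each entry adds at least one.
length≤∣fromList∣ : {xs : List (Fin n)} → Unique xs → length xs ≤ ∣ fromList xs ∣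
length≤∣fromList∣               []           = z≤n
length≤∣fromList∣ {xs = x ∷ xs} u@(_ ∷ uniq) = ≤-<-trans (length≤∣fromList∣ uniq)
  (p⊂q⇒∣p∣<∣q∣
    ( q⊆p∪q ⁅ x ⁆ _ , x , p⊆p∪q (fromList xs) (x∈⁅x⁆ x)
    , Unique[x∷xs]⇒x∉xs u ∘ ∈-fromList⁻ xs))

-- Shrinking a dominating family

module _ {A : Set a} {p} {P : A → Set p} (P? : Unary.Decidable P) where

  length-filter-∁ : ∀ xs → length xs ≡ length (filter P? xs) + length (filter (∁? P?) xs)
  length-filter-∁ []       = refl
  length-filter-∁ (x ∷ xs) with ih ← length-filter-∁ xs | does (P? x)
  ... | true  = cong suc ih
  ... | false = trans (cong suc ih) (sym (+-suc _ _))

take-⊆ : {A : Set a} (n : ℕ) (xs : List A) → take n xs ⊆ xs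
take-⊆ n xs = All.lookup (All.take⁺ n (All.tabulate id))

module _ {A : Set a} {B : Set b} {R : REL A B r} (R? : Decidable R) where

  Dominates : List B → List A → Set _
  Dominates bs as = ∀ {x} → x ∈ as → Any (R x) bs

  -- Induction on `bs`, where `m` is the surplus still wanted. The head `b` is judged by the number
  -- of elements of `as` that it dominates; the tail dominates all others. The equality in the
  -- conclusion, with the bound on `bs′`, later limits the total size.
  shrink : ∀ {as} bs m → Unique as → Dominates bs as → length bs + m ≤ length as →
           ∃₂ λ as′ bs′ → as′ ⊆ as × bs′ ⊆ bs × Unique as′ × Dominates bs′ as′
             × length as′ ≡ length bs′ + m × length bs′ ≤ m
  shrink bs zero _ _ _ =
    [] , [] , (λ ()) , (λ ()) , [] , (λ ()) , refl , z≤n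
  shrink {[]}     []       (suc m) _ _   ()
  shrink {x ∷ as} []       (suc m) _ dom _ with () ← dom (here refl)
  shrink {as}     (b ∷ bs) m@(suc m-1) uniq dom le = by-size (length N) refl
    where
    Rb? : Unary.Decidable (λ x → R x b)
    Rb? x = R? x b

    N rest : List A
    N    = filter Rb? as
    rest = filter (∁? Rb?) as

    N⊆as : N ⊆ as
    N⊆as = proj₁ ∘ ∈-filter⁻ Rb?

    rest⊆as : rest ⊆ as
    rest⊆as = proj₁ ∘ ∈-filter⁻ (∁? Rb?)

    N-dom : ∀ {x} → x ∈ N → R x b
    N-dom = proj₂ ∘ ∈-filter⁻ Rb? {xs = as}

    rest-uniq : Unique rest
    rest-uniq = Unique.filter⁺ (∁? Rb?) uniq

    rest-dom : Dominates bs rest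
    rest-dom x∈ with x∈as , ¬Rxb ← ∈-filter⁻ (∁? Rb?) {xs = as} x∈ | dom x∈as
    ... | here Rxb = contradiction Rxb ¬Rxb
    ... | there d  = d

    total : length (b ∷ bs) + m ≤ length N + length rest
    total = ≤-trans le (≤-reflexive (length-filter-∁ Rb? as))

    Result : Set _
    Result = ∃₂ λ as′ bs′ → as′ ⊆ as × bs′ ⊆ (b ∷ bs) × Unique as′ × Dominates bs′ as′
               × length as′ ≡ length bs′ + m × length bs′ ≤ m

    drop-b : length bs + m ≤ length rest → Result
    drop-b le′ with as′ , bs′ , as′⊆ , bs′⊆ , rem ← shrink bs m rest-uniq rest-dom le′ =
      as′ , bs′ , rest⊆as ∘ as′⊆ , there ∘ bs′⊆ , rem

    -- More than `m` dominated elements beat the single vertex `b` by `m`; `take` cuts them to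
    -- exactly `suc m`.
    only-b : m < length N → Result
    only-b m<N = take (suc m) N , [ b ] , N⊆as ∘ take-⊆ (suc m) N , (λ { (here eq) → here eq })
      , Unique.take⁺ (suc m) (Unique.filter⁺ Rb? uniq)
      , here ∘ N-dom ∘ take-⊆ (suc m) N
      , trans (length-take (suc m) N) (m≤n⇒m⊓n≡m m<N)
      , s≤s z≤n

    -- Here `b` dominates `suc (suc j)` elements, a net gain of `suc j`, so the tail has to supply
    -- only `m′`.
    keep-b : ∀ j m′ → length N ≡ suc (suc j) → suc j + m′ ≡ m → Result
    keep-b j m′ ∣N∣≡ m≡ =
      let as′ , bs′ , as′⊆ , bs′⊆ , uniq′ , dom′ , ∣as′∣≡ , ∣bs′∣≤ = shrink bs m′ rest-uniq rest-dom le′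
      in  N ++ as′ , b ∷ bs′
        , [ N⊆as , rest⊆as ∘ as′⊆ ]′ ∘ ∈-++⁻ N
        , (λ { (here eq) → here eq ; (there x∈) → there (bs′⊆ x∈) })
        , Unique.++⁺ (Unique.filter⁺ Rb? uniq) uniq′
            (λ (x∈N , x∈as′) → proj₂ (∈-filter⁻ (∁? Rb?) {xs = as} (as′⊆ x∈as′)) (N-dom x∈N))
        , [ here ∘ N-dom , there ∘ dom′ ]′ ∘ ∈-++⁻ N
        , trans (length-++ N) (trans (cong₂ _+_ ∣N∣≡ ∣as′∣≡) (regroup (length bs′)))
        -- One more kept vertex fits under the bound because the gain `suc j` is at least one.
        , subst (suc (length bs′) ≤_) m≡ (s≤s (≤-trans ∣bs′∣≤ (m≤n+m m′ j)))
      where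
      identity : ∀ j l m′ → suc (suc j) + (l + m′) ≡ suc l + (suc j + m′)
      identity = solve-∀
      regroup : ∀ l → suc (suc j) + (l + m′) ≡ suc l + m
      regroup l = trans (identity j l m′) (cong (suc l +_) m≡)
      -- Both sides of `total` contain `suc (suc j)`: on the left it is `b` together with the gain
      -- `suc j` taken out of `m`.
      le′ : length bs + m′ ≤ length rest
      le′ = +-cancelˡ-≤ (suc (suc j)) _ _
        (subst₂ _≤_ (sym (regroup (length bs))) (cong (_+ length rest) ∣N∣≡) total)

    by-size : ∀ s → length N ≡ s → Result
    -- Dropping `b` frees one unit on the left of `total`, which pays for the at most one element of
    -- `as` lost with it.
    by-size 0             eq = drop-b (<⇒≤ (subst (λ s → suc (length bs) + m ≤ s + length rest) eq total))
    by-size 1             eq = drop-b (s≤s⁻¹ (subst (λ s → suc (length bs) + m ≤ s + length rest) eq total))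
    by-size (suc (suc j)) eq with suc m ≤? length N
    ... | yes m<N = only-b m<N
    ... | no  m≮N with m′ , m≡ ← m≤n⇒∃[o]m+o≡n (<⇒≤ (subst (_≤ m) eq (≮⇒≥ m≮N))) =
      keep-b j m′ eq m≡

-- Dominated pairs

module _ (G : Graph) where
  open Graph G using (_~_; _~?_)

  IndependentList : List (Vertex G) → Set
  IndependentList xs = ∀ {u v} → u ∈ xs → v ∈ xs → ¬ (u ~ v)

  -- The closed neighbourhood relation; equality is included because the two sets of a pair may
  -- overlap.
  Near : Vertex G → Vertex G → Set
  Near u v = u ≡ v ⊎ u ~ v

  near? : Decidable Near
  near? u v = (u ≟ᶠ v) ⊎-dec (u ~? v)

  -- The pair A, B of the overview. Repetitions in `as` would fake a surplus, hence `unique`;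
  -- repetitions in `bs` only make `excess` stronger.
  record Surplus (as bs : List (Vertex G)) (m : ℕ) : Set where
    field
      unique    : Unique as
      indepˡ    : IndependentList as
      indepʳ    : IndependentList bs
      dominated : Dominates near? bs as
      excess    : length bs + m ≤ length as

  -- Independence passes to sublists, so `shrink` applies. It leaves at most `m` entries in `bs′`
  -- and hence at most `2 * m` in `as′`.
  shrink-surplus : ∀ {as bs} → Surplus as bs m →
                   ∃₂ λ as′ bs′ → Surplus as′ bs′ m × length (as′ ++ bs′) ≤ 3 * m
  shrink-surplus {m} {bs = bs} s
    with as′ , bs′ , as′⊆ , bs′⊆ , uniq , dom , ∣as′∣≡ , ∣bs′∣≤
         ← shrink near? bs m (Surplus.unique s) (Surplus.dominated s) (Surplus.excess s) =
      as′ , bs′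
    , record
        { unique    = uniq
        ; indepˡ    = λ u∈ v∈ → indepˡ (as′⊆ u∈) (as′⊆ v∈)
        ; indepʳ    = λ u∈ v∈ → indepʳ (bs′⊆ u∈) (bs′⊆ v∈)
        ; dominated = dom
        ; excess    = ≤-reflexive (sym ∣as′∣≡)
        }
    , (begin
        length (as′ ++ bs′)           ≡⟨ length-++ as′ ⟩
        length as′ + length bs′       ≡⟨ cong (_+ length bs′) ∣as′∣≡ ⟩
        length bs′ + m + length bs′   ≤⟨ +-mono-≤ (+-monoˡ-≤ m ∣bs′∣≤) ∣bs′∣≤ ⟩
        m + m + m                     ≡⟨ triple m ⟩
        3 * m                         ∎)
    where
    open Surplus s
    open ≤-Reasoning
    triple : ∀ m → m + m + m ≡ 3 * m
    triple = solve-∀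

-- Induced embeddings and the transport of dominated pairs

record _↪_ (H G : Graph) : Set where
  open Graph H using () renaming (_~_ to _~ᴴ_)
  open Graph G using () renaming (_~_ to _~ᴳ_)
  field
    embed     : Vertex H → Vertex G
    injective : Injective _≡_ _≡_ embed
    adjacency : ∀ u v → (u ~ᴴ v) ⇔ (embed u ~ᴳ embed v)

induced : (S : Subset (order G)) → (G ⟨ S ⟩) ↪ G
induced S = record
  { embed     = element S
  ; injective = element-injective S
  ; adjacency = λ _ _ → ⇔-id _
  }

≅-sym : G ≅ H → H ≅ G
≅-sym {G} {H} iso = record
  { bijection = ↔-sym bijection
  ; adjacency = λ u v → mk⇔
      (from (adjacency _ _) ∘ subst₂ _~_ (sym (strictlyInverseˡ u)) (sym (strictlyInverseˡ v)))
      (subst₂ _~_ (strictlyInverseˡ u) (strictlyInverseˡ v) ∘ to (adjacency _ _))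
  }
  where
  open _≅_ iso
  open Inverse bijection using (strictlyInverseˡ)
  open Graph H using (_~_)

≅⇒↪ : G ≅ H → G ↪ H
≅⇒↪ iso = record
  { embed     = Inverse.to bijection
  ; injective = Injection.injective (↔⇒↣ bijection)
  ; adjacency = adjacency
  }
  where open _≅_ iso

module _ (f : H ↪ G) where
  open _↪_ f

  -- Independence needs adjacency reflected, domination needs it preserved, and `unique` needs
  -- injectivity.
  surplus-map⁺ : ∀ {as bs} → Surplus H as bs m → Surplus G (map embed as) (map embed bs) m
  surplus-map⁺ {m} {as} {bs} s = record
    { unique    = Unique.map⁺ injective unique
    ; indepˡ    = independent indepˡ
    ; indepʳ    = independent indepʳ
    ; dominated = dom
    ; excess    = subst₂ (λ p q → p + m ≤ q) (sym (length-map embed bs)) (sym (length-map embed as)) excess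
    }
    where
    open Surplus s
    independent : ∀ {xs} → IndependentList H xs → IndependentList G (map embed xs)
    independent ind u∈ v∈ u~v
      with u , u∈′ , refl ← ∈-map⁻ embed u∈ | v , v∈′ , refl ← ∈-map⁻ embed v∈ =
      ind u∈′ v∈′ (from (adjacency u v) u~v)
    dom : Dominates (near? G) (map embed bs) (map embed as)
    dom x∈ with u , u∈ , refl ← ∈-map⁻ embed x∈ =
      Any.map⁺ (Any.map (Sum.map (cong embed) (to (adjacency u _))) (dominated u∈))

  surplus-map⁻ : ∀ {as bs} → Surplus G (map embed as) (map embed bs) m → Surplus H as bs m
  surplus-map⁻ {m} {as} {bs} s = record
    { unique    = Unique.map⁻ unique
    ; indepˡ    = independent indepˡ
    ; indepʳ    = independent indepʳ
    ; dominated = λ {u} u∈ → Any.map (Sum.map injective (from (adjacency u _)))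
                               (Any.map⁻ (dominated (∈-map⁺ embed u∈)))
    ; excess    = subst₂ (λ p q → p + m ≤ q) (length-map embed bs) (length-map embed as) excess
    }
    where
    open Surplus s
    independent : ∀ {xs} → IndependentList G (map embed xs) → IndependentList H xs
    independent ind {u} {v} u∈ v∈ u~v =
      ind (∈-map⁺ embed u∈) (∈-map⁺ embed v∈) (to (adjacency u v) u~v)

-- Dominated pairs and the gap

module _ (G : Graph) where
  open Graph G using (_~_; _~?_; ~-sym; ~-irr)

  ∣independent∣≤α : ∀ {S} → Independent G S → ∣ S ∣ ≤ α G
  ∣independent∣≤α {S} ind = v≤max⁺ 0 _
    (inj₂ (lose (∈-map⁺ ∣_∣ (∈-filter⁺ (independent? G) (subsets-complete S) ind)) ≤-refl))

  i≤∣maximalIndependent∣ : ∀ {S} → MaximalIndependent G S → i G ≤ ∣ S ∣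
  i≤∣maximalIndependent∣ {S} ind = min≤v⁺ (order G) _
    (inj₂ (lose (∈-map⁺ ∣_∣ (∈-filter⁺ (maximalIndependent? G) (subsets-complete S) ind)) ≤-refl))

  α≤order : α G ≤ order G
  α≤order = max≤v⁺ {xs = map ∣_∣ independents} z≤n (All.map⁺ (All.tabulate λ {S} _ → ∣p∣≤n S))
    where
    independents : List (Subset (order G))
    independents = filter (independent? G) (subsets (order G))

  -- A positive gap excludes the default values of `max` and `min`, so both extrema come from actual
  -- sets.
  gap-attained : 0 < gap G →
                 ∃₂ λ A B → Independent G A × MaximalIndependent G B × α G ≡ ∣ A ∣ × i G ≡ ∣ B ∣
  gap-attained 0<gap
    with argmax-sel id 0 (map ∣_∣ (filter (independent? G) (subsets (order G))))
       | argmin-sel id (order G) (map ∣_∣ (filter (maximalIndependent? G) (subsets (order G))))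
  ... | inj₁ α≡0 | _       = contradiction 0<gap (<-irrefl (sym gap≡0))
    where
    gap≡0 : gap G ≡ 0
    gap≡0 = trans (cong (_∸ i G) α≡0) (0∸n≡0 (i G))
  -- With `i G` at its default, `α≤order` makes the subtraction truncate to zero.
  ... | inj₂ _   | inj₁ i≡order = contradiction 0<gap (<-irrefl (sym gap≡0))
    where
    gap≡0 : gap G ≡ 0
    gap≡0 = trans (cong (α G ∸_) i≡order) (m≤n⇒m∸n≡0 α≤order)
  ... | inj₂ α∈  | inj₂ i∈
    with A , _ , α≡ , indA ← ∈-map∘filter⁻ ∣_∣ (independent? G) {xs = subsets (order G)} α∈
       | B , _ , i≡ , maxB ← ∈-map∘filter⁻ ∣_∣ (maximalIndependent? G) {xs = subsets (order G)} i∈ =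
    A , B , indA , maxB , α≡ , i≡

  independent-elements : ∀ {S} → Independent G S → IndependentList G (elements S)
  independent-elements {S} ind u∈ v∈ = ind _ _ (∈-elements⁻ S u∈) (∈-elements⁻ S v∈)

  -- A vertex near no element of `S` could be added to `S` without losing independence.
  maximalIndependent-dominates : ∀ {S} → MaximalIndependent G S → ∀ u → Any (Near G u) (elements S)
  maximalIndependent-dominates {S} (ind , maximal) u with any? (near? G u) (elements S)
  ... | yes near = near
  ... | no ¬near = contradiction (⁅ u ⁆ ∪ S , S⊂ , ind′) maximal
    where
    u∉S : ¬ (u ∈ˢ S)
    u∉S u∈ = ¬near (lose (∈-elements⁺ S u∈) (inj₁ refl))
    S⊂ : S Subset.⊂ (⁅ u ⁆ ∪ S)
    S⊂ = q⊆p∪q ⁅ u ⁆ S , u , p⊆p∪q S (x∈⁅x⁆ u) , u∉S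
    u≁S : ∀ {v} → v ∈ˢ S → ¬ (u ~ v)
    u≁S v∈ u~v = ¬near (lose (∈-elements⁺ S v∈) (inj₂ u~v))
    ind′ : Independent G (⁅ u ⁆ ∪ S)
    ind′ v w v∈ w∈ v~w with x∈p∪q⁻ ⁅ u ⁆ S v∈ | x∈p∪q⁻ ⁅ u ⁆ S w∈
    ... | inj₂ v∈S | inj₂ w∈S = ind v w v∈S w∈S v~w
    ... | inj₁ v∈u | inj₂ w∈S with refl ← x∈⁅y⁆⇒x≡y u v∈u = u≁S w∈S v~w
    ... | inj₂ v∈S | inj₁ w∈u with refl ← x∈⁅y⁆⇒x≡y u w∈u = u≁S v∈S (~-sym v~w)
    ... | inj₁ v∈u | inj₁ w∈u = ~-irr (trans (x∈⁅y⁆⇒x≡y u v∈u) (sym (x∈⁅y⁆⇒x≡y u w∈u))) v~w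

  gap⇒surplus : 0 < m → m ≤ gap G → ∃₂ λ as bs → Surplus G as bs m
  gap⇒surplus {m} 0<m m≤gap
    with A , B , indA , maxB , α≡ , i≡ ← gap-attained (<-≤-trans 0<m m≤gap) =
    elements A , elements B , record
      { unique    = Unique.tabulate⁺ (element-injective A)
      ; indepˡ    = independent-elements indA
      ; indepʳ    = independent-elements (proj₁ maxB)
      ; dominated = λ {u} _ → maximalIndependent-dominates maxB u
      ; excess    = begin
          length (elements B) + m ≡⟨ cong (_+ m) (length-tabulate (element B)) ⟩
          ∣ B ∣ + m               ≡⟨ cong (_+ m) i≡ ⟨
          i G + m                 ≡⟨ +-comm (i G) m ⟩
          m + i G                 ≤⟨ m≤o∸n⇒m+n≤o m i≤α m≤gap ⟩
          α G                     ≡⟨ α≡ ⟩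
          ∣ A ∣                   ≡⟨ length-tabulate (element A) ⟨
          length (elements A)     ∎
      }
    where
    open ≤-Reasoning
    -- A nonzero truncated difference forces `i G` below `α G`.
    i≤α : i G ≤ α G
    i≤α = <⇒≤ (m∸n≢0⇒n<m (m<n⇒n≢0 (<-≤-trans 0<m m≤gap)))

  -- Since the pair covers the graph, `bs` dominates every vertex and is therefore maximal. It
  -- bounds `i G` from above, while `as` bounds `α G` from below.
  surplus⇒gap : ∀ {as bs} → Surplus G as bs m → (∀ u → u ∈ as ++ bs) → m ≤ gap G
  surplus⇒gap {m} {as} {bs} s cover = m+n≤o⇒m≤o∸n m (begin
    m + i G                 ≤⟨ +-monoʳ-≤ m (i≤∣maximalIndependent∣ maxB) ⟩
    m + ∣ fromList bs ∣     ≤⟨ +-monoʳ-≤ m (∣fromList∣≤length bs) ⟩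
    m + length bs           ≡⟨ +-comm m _ ⟩
    length bs + m           ≤⟨ excess ⟩
    length as               ≤⟨ length≤∣fromList∣ unique ⟩
    ∣ fromList as ∣         ≤⟨ ∣independent∣≤α (independent indepˡ) ⟩
    α G                     ∎)
    where
    open Surplus s
    open ≤-Reasoning
    independent : ∀ {xs} → IndependentList G xs → Independent G (fromList xs)
    independent {xs} ind u v u∈ v∈ = ind (∈-fromList⁻ xs u∈) (∈-fromList⁻ xs v∈)
    near-bs : ∀ u → Any (Near G u) bs
    near-bs u = [ dominated , Any.map inj₁ ]′ (∈-++⁻ as (cover u))
    maxB : MaximalIndependent G (fromList bs)
    -- A new vertex `u` of `T` is near some `v` in `bs`: equality contradicts `u∉B`, adjacency
    -- contradicts `indT`.
    maxB = independent indepʳ , λ (T , (B⊆T , u , u∈T , u∉B) , indT) →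
      let v , v∈bs , near = find (near-bs u)
          v∈B = ∈-fromList⁺ v∈bs
      in [ (λ u≡v → u∉B (subst (_∈ˢ fromList bs) (sym u≡v) v∈B)) , indT u v u∈T (B⊆T v∈B) ]′ near

-- Induced subgraphs and the hereditary gap

map-element-surjective : (S : Subset n) {xs : List (Fin n)} → (∀ {v} → v ∈ xs → v ∈ˢ S) →
                         ∃[ ys ] map (element S) ys ≡ xs
map-element-surjective S {[]}     xs⊆S = [] , refl
map-element-surjective S {x ∷ xs} xs⊆S
  with y , refl ← element-surjective S (xs⊆S (here refl))
     | ys , refl ← map-element-surjective S (xs⊆S ∘ there) = y ∷ ys , refl

-- Restricting to the vertices of the pair secures the covering condition of `surplus⇒gap`.
surplus⇒gap-induced : ∀ {as bs} → Surplus G as bs m → m ≤ gap (G ⟨ fromList (as ++ bs) ⟩)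
surplus⇒gap-induced {G} {m} {as} {bs} s
  with xs , as≡ ← map-element-surjective (fromList (as ++ bs)) {as} (∈-fromList⁺ ∘ ∈-++⁺ˡ)
     | ys , bs≡ ← map-element-surjective (fromList (as ++ bs)) {bs} (∈-fromList⁺ ∘ ∈-++⁺ʳ as) =
  surplus⇒gap (G ⟨ T ⟩) (surplus-map⁻ (induced {G} T) (subst₂ (λ p q → Surplus G p q m) (sym as≡) (sym bs≡) s))
    λ u → [ ∈-++⁺ˡ ∘ back as≡ , ∈-++⁺ʳ xs ∘ back bs≡ ]′ (∈-++⁻ as (∈-fromList⁻ (as ++ bs) (element-∈ T u)))
  where
  T : Subset (order G)
  T = fromList (as ++ bs)
  back : ∀ {u zs ws} → map (element T) zs ≡ ws → element T u ∈ ws → u ∈ zs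
  back {zs = zs} refl u∈ =
    let _ , v∈ , eq = ∈-map⁻ (element T) u∈ in subst (_∈ zs) (sym (element-injective T eq)) v∈

gap-induced≤hereditaryGap : (S : Subset (order G)) → gap (G ⟨ S ⟩) ≤ hereditaryGap G
gap-induced≤hereditaryGap S = v≤max⁺ 0 _ (inj₂ (lose (∈-map⁺ _ (subsets-complete S)) ≤-refl))

surplus⇒hereditaryGap : ∀ {as bs} → Surplus G as bs m → m ≤ hereditaryGap G
surplus⇒hereditaryGap {G} {as = as} {bs} s =
  ≤-trans (surplus⇒gap-induced s) (gap-induced≤hereditaryGap {G} (fromList (as ++ bs)))

-- As `m` is positive, the maximum is not the default `0` but the gap of some induced subgraph,
-- whose pair embeds in `G`.
hereditaryGap⇒surplus : 0 < m → m ≤ hereditaryGap G → ∃₂ λ as bs → Surplus G as bs m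
hereditaryGap⇒surplus {m} {G} 0<m m≤
  with argmax-sel id 0 (map (λ S → gap (G ⟨ S ⟩)) (subsets (order G)))
... | inj₁ ≡0 = contradiction (<-≤-trans 0<m m≤) (<-irrefl (sym ≡0))
... | inj₂ ∈gaps
  with S , _ , eq ← ∈-map⁻ (λ S → gap (G ⟨ S ⟩)) ∈gaps
  with _ , _ , s ← gap⇒surplus (G ⟨ S ⟩) 0<m (subst (m ≤_) eq m≤) =
  _ , _ , surplus-map⁺ (induced {G} S) s

-- A pair witnessing the value for `H` is carried into `G`. Arguing by contradiction makes that
-- value positive, as extracting the pair requires.
hereditaryGap-mono : H ↪ G → hereditaryGap H ≤ hereditaryGap G
hereditaryGap-mono {H} f = ≮⇒≥ λ gap< →
  let _ , _ , s = hereditaryGap⇒surplus {G = H} (≤-<-trans z≤n gap<) ≤-refl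
  in <⇒≱ gap< (surplus⇒hereditaryGap (surplus-map⁺ f s))

-- Membership in `as` is the colouring: one class lies in `as`, the other in `bs`, and both are
-- independent.
surplus⇒bipartite : ∀ {as bs} → Surplus G as bs m → Bipartite (G ⟨ fromList (as ++ bs) ⟩)
surplus⇒bipartite {G} {as = as} {bs} s = colour , proper
  where
  open Surplus s
  T = fromList (as ++ bs)
  open Graph (G ⟨ T ⟩) using (_~_)
  colour = λ u → does (any? (element T u ≟ᶠ_) as)
  in-bs : ∀ u → ¬ (element T u ∈ as) → element T u ∈ bs
  in-bs u u∉ = [ (λ u∈ → contradiction u∈ u∉) , id ]′ (∈-++⁻ as (∈-fromList⁻ (as ++ bs) (element-∈ T u)))
  proper : ∀ u v → u ~ v → colour u ≢ colour v
  proper u v u~v with any? (element T u ≟ᶠ_) as | any? (element T v ≟ᶠ_) as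
  ... | yes u∈ | yes v∈ = λ _ → indepˡ u∈ v∈ u~v
  ... | yes _  | no  _  = λ ()
  ... | no  _  | yes _  = λ ()
  ... | no  u∉ | no  v∉ = λ _ → indepʳ (in-bs u u∉) (in-bs v v∉) u~v

-- Enumerating bipartite graphs

-- `c` is a 2-colouring and `M` an arbitrary 0/1 matrix flattened by `combine`. Asking for both
-- entries and distinct colours makes every code a valid bipartite graph.
bipartiteGraph : Subset n → Subset (n * n) → Graph
bipartiteGraph {n} c M = record
  { order = n
  ; _~_   = λ u v → Vec.lookup c u ≢ Vec.lookup c v × combine u v ∈ˢ M × combine v u ∈ˢ M
  ; _~?_  = λ u v → ¬? (Vec.lookup c u ≟ᵇ Vec.lookup c v)
                      ×-dec (combine u v Subset.∈? M) ×-dec (combine v u Subset.∈? M)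
  ; ~-sym = λ (c≢ , uv , vu) → c≢ ∘ sym , vu , uv
  ; ~-irr = λ { refl (c≢ , _) → c≢ refl }
  }

bipartiteGraphs : ℕ → List Graph
bipartiteGraphs n = cartesianProductWith bipartiteGraph (subsets n) (subsets (n * n))

bipartiteGraphs-bipartite : ∀ {F} → F ∈ bipartiteGraphs n → Bipartite F
bipartiteGraphs-bipartite {n} F∈
  with c , M , _ , _ , refl ← ∈-cartesianProductWith⁻ bipartiteGraph (subsets n) (subsets (n * n)) F∈ =
  Vec.lookup c , λ _ _ → proj₁

bipartiteGraphs-complete : ∀ G → Bipartite G → ∃[ F ] F ∈ bipartiteGraphs (order G) × G ≅ F
bipartiteGraphs-complete G (c , proper) =
    bipartiteGraph (Vec.tabulate c) M
  , ∈-cartesianProductWith⁺ bipartiteGraph (subsets-complete (Vec.tabulate c)) (subsets-complete M)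
  , record
    { bijection = ↔-id _
    ; adjacency = λ u v → mk⇔
        (λ u~v → subst₂ _≢_ (sym (lookup∘tabulate c u)) (sym (lookup∘tabulate c v)) (proper u v u~v)
               , ∈M⁺ u~v , ∈M⁺ (~-sym u~v))
        (λ (_ , uv∈M , _) → ∈M⁻ uv∈M)
    }
  where
  open Graph G using (_~_; _~?_; ~-sym)
  edge? : ∀ x → Dec (uncurry _~_ (remQuot (order G) x))
  edge? x = uncurry _~?_ (remQuot (order G) x)
  edges : List (Fin (order G * order G))
  edges = filter edge? (allFin _)
  M : Subset (order G * order G)
  M = fromList edges
  ∈M⁺ : ∀ {u v} → u ~ v → combine u v ∈ˢ M
  ∈M⁺ {u} {v} u~v = ∈-fromList⁺
    (∈-filter⁺ edge? (∈-allFin _) (subst (uncurry _~_) (sym (remQuot-combine u v)) u~v))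
  ∈M⁻ : ∀ {u v} → combine u v ∈ˢ M → u ~ v
  ∈M⁻ {u} {v} uv∈M = subst (uncurry _~_) (remQuot-combine u v)
    (proj₂ (∈-filter⁻ edge? {xs = allFin _} (∈-fromList⁻ edges uv∈M)))

-- The obstructions

smallBipartiteGraphs : ℕ → List Graph
-- `upTo (suc n)` ends at `n`, so order `n` itself is included.
smallBipartiteGraphs n = concatMap bipartiteGraphs (upTo (suc n))

exceeds? : ∀ k F → Dec (k < hereditaryGap F)
exceeds? k F = k <? hereditaryGap F

-- The cutoff is the size bound of `shrink-surplus` for surplus `suc k`.
obstructions : ℕ → List Graph
obstructions k = filter (exceeds? k) (smallBipartiteGraphs (3 * suc k))

obstructions-bipartite : ∀ k → All Bipartite (obstructions k)
obstructions-bipartite k = All.tabulate λ F∈ →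
  let F∈small , _ = ∈-filter⁻ (exceeds? k) {xs = smallBipartiteGraphs (3 * suc k)} F∈
      n , _ , F∈n = find (∈-concatMap⁻ bipartiteGraphs {xs = upTo (suc (3 * suc k))} F∈small)
  in bipartiteGraphs-bipartite {n} F∈n

obstructed : ∀ k G → k < hereditaryGap G → ∃[ S ] Any (λ F → G ⟨ S ⟩ ≅ F) (obstructions k)
obstructed k G k<
  with _ , _ , s₀ ← hereditaryGap⇒surplus {G = G} (s≤s z≤n) k<
  with as , bs , s , small ← shrink-surplus G s₀
  with F , F∈ , iso ← bipartiteGraphs-complete (G ⟨ fromList (as ++ bs) ⟩) (surplus⇒bipartite s) =
  T , lose (∈-filter⁺ (exceeds? k) (∈-concatMap⁺ bipartiteGraphs (lose (∈-upTo⁺ (s≤s ∣T∣≤)) F∈)) k<F) iso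
  where
  T : Subset (order G)
  T = fromList (as ++ bs)
  ∣T∣≤ : ∣ T ∣ ≤ 3 * suc k
  ∣T∣≤ = ≤-trans (∣fromList∣≤length (as ++ bs)) small
  -- The pair `s` lives in `G`; the gap of the induced subgraph yields one inside it, which `iso`
  -- moves to `F`.
  s′ : ∃₂ λ as bs → Surplus (G ⟨ T ⟩) as bs (suc k)
  s′ = gap⇒surplus (G ⟨ T ⟩) (s≤s z≤n) (surplus⇒gap-induced s)
  k<F : k < hereditaryGap F
  k<F = surplus⇒hereditaryGap (surplus-map⁺ (≅⇒↪ iso) (proj₂ (proj₂ s′)))

mainTheorem15 : (k : ℕ) → Σ[ 𝓕 ∈ List Graph ] (All Bipartite 𝓕 × ((G : Graph) → (hereditaryGap G ≤ k) ⇔ (𝓕 -Free G)))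
mainTheorem15 k = obstructions k , obstructions-bipartite k , λ G → mk⇔ (free G) (bounded G)
  where
  free : ∀ G → hereditaryGap G ≤ k → obstructions k -Free G
  free G ≤k (S , S≅) =
    let F , F∈ , iso = find S≅
        k<F = proj₂ (∈-filter⁻ (exceeds? k) {xs = smallBipartiteGraphs (3 * suc k)} F∈)
    -- The hereditary gap grows from `F` to its copy `G ⟨ S ⟩` and on to `G`.
    in <⇒≱ (<-≤-trans k<F (≤-trans (hereditaryGap-mono (≅⇒↪ (≅-sym iso))) (hereditaryGap-mono (induced {G} S)))) ≤k
  bounded : ∀ G → obstructions k -Free G → hereditaryGap G ≤ k
  bounded G free = ≮⇒≥ (free ∘ obstructed k G)
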